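{- If $G$ and $G'$ are non-isomorphic graphs that have the same order $n$, then $\mathrm{D}_0(G,G')\le (n+5)/2$.
   Context: Graphs are finite, undirected and loopless; the order is the number of vertices. A graph is regarded as a structure with a single irreflexive symmetric binary predicate $E$ (adjacency). First order formulas use $E$, $=$ and the connectives $\neg,\wedge,\vee$. A closed formula $\Phi$ distinguishes $G$ from $G'$ if it is true on $G$ and false on $G'$. The set $\mathrm{Nest}(\Phi)$ of sequences of nested quantifiers is defined inductively: $\mathrm{Nest}(\Phi)=\{\epsilon\}$ (the empty word) for atomic $\Phi$; $\mathrm{Nest}(\neg\Phi)$ is obtained from $\mathrm{Nest}(\Phi)$ by exchanging $\exists$ and $\forall$ in all words; $\mathrm{Nest}(\Phi\wedge\Psi)=\mathrm{Nest}(\Phi\vee\Psi)=\mathrm{Nest}(\Phi)\cup\mathrm{Nest}(\Psi)$; $\mathrm{Nest}(\exists x\Phi)$ and $\mathrm{Nest}(\forall x\Phi)$ are obtained by prepending $\exists$, respectively $\forall$, to every word of $\mathrm{Nest}(\Phi)$. The quantifier rank of $\Phi$ is the maximum length of a word in $\mathrm{Nest}(\Phi)$; the alternation number of $\Phi$ is the maximum, over words in $\mathrm{Nest}(\Phi)$, of the number of occurrences of $\exists\forall$ and $\forall\exists$ as consecutive letters. $\mathrm{D}_0(G,G')$ is the minimum quantifier rank of a formula with alternation number $0$ distinguishing $G$ from $G'$. -}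

module Defs where

open import Data.Fin.Base using (Fin)
open import Data.List.Base using (List; []; _∷_; [_]; _++_; map; length)
open import Data.List.Extrema.Nat using (max)
open import Data.Nat.Base using (ℕ; zero; suc; _≤_)
open import Data.Product.Base using (Σ-syntax; ∃-syntax; _×_)
open import Data.Sum.Base using (_⊎_)
open import Data.Vec.Base using (Vec; []; _∷_; lookup)
open import Function.Bundles using (_↔_; _⇔_; module Inverse)
open import Level using (0ℓ)
open import Relation.Binary.Core using (Rel)
open import Relation.Binary.Definitions using (Decidable; Symmetric; Irreflexive)
open import Relation.Binary.PropositionalEquality.Core using (_≡_)
open import Relation.Nullary.Negation.Core using (¬_)

-- Finite simple graphs of order n, with vertex set Fin n.

record Graph (n : ℕ) : Set₁ where
  field
    Adj        : Rel (Fin n) 0ℓ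
    Adj?       : Decidable Adj
    Adj-sym    : Symmetric Adj
    Adj-irrefl : Irreflexive _≡_ Adj

open Graph public using (Adj)

infix 4 _≅_

_≅_ : ∀ {m n} → Graph m → Graph n → Set
_≅_ {m} {n} G G′ =
  Σ[ f ∈ Fin m ↔ Fin n ] (∀ u v → Adj G u v ⇔ Adj G′ (Inverse.to f u) (Inverse.to f v))

-- Formula k has its free variables among k de Bruijn indices; index zero
-- refers to the innermost quantifier.

infixr 6 _∧′_
infixr 5 _∨′_

data Formula (k : ℕ) : Set where
  E′   : Fin k → Fin k → Formula k
  _≈′_ : Fin k → Fin k → Formula k
  ¬′_  : Formula k → Formula k
  _∧′_ : Formula k → Formula k → Formula k
  _∨′_ : Formula k → Formula k → Formula k
  ∃′_  : Formula (suc k) → Formula k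
  ∀′_  : Formula (suc k) → Formula k

Closed : Set
Closed = Formula zero

-- Every instance of Sat is decidable, since vertices range over Fin n and Adj
-- is decidable, so this agrees with the classical truth definition.

Sat : ∀ {n k} → Graph n → Vec (Fin n) k → Formula k → Set
Sat G ρ (E′ x y) = Adj G (lookup ρ x) (lookup ρ y)
Sat G ρ (x ≈′ y) = lookup ρ x ≡ lookup ρ y
Sat G ρ (¬′ Φ)   = ¬ Sat G ρ Φ
Sat G ρ (Φ ∧′ Ψ) = Sat G ρ Φ × Sat G ρ Ψ
Sat G ρ (Φ ∨′ Ψ) = Sat G ρ Φ ⊎ Sat G ρ Ψ
Sat G ρ (∃′ Φ)   = ∃[ v ] Sat G (v ∷ ρ) Φ
Sat G ρ (∀′ Φ)   = ∀ v → Sat G (v ∷ ρ) Φ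

infix 4 _⊨_

_⊨_ : ∀ {n} → Graph n → Closed → Set
G ⊨ Φ = Sat G [] Φ

Distinguishes : ∀ {m n} → Closed → Graph m → Graph n → Set
Distinguishes Φ G G′ = G ⊨ Φ × ¬ (G′ ⊨ Φ)

data Quantifier : Set where
  ex all : Quantifier

exchange : Quantifier → Quantifier
exchange ex  = all
exchange all = ex

-- A set of words is given by a list; repetitions and order play no role below.

Nest : ∀ {k} → Formula k → List (List Quantifier)
Nest (E′ x y) = [ [] ]
Nest (x ≈′ y) = [ [] ]
Nest (¬′ Φ)   = map (map exchange) (Nest Φ)
Nest (Φ ∧′ Ψ) = Nest Φ ++ Nest Ψ
Nest (Φ ∨′ Ψ) = Nest Φ ++ Nest Ψ
Nest (∃′ Φ)   = map (ex ∷_) (Nest Φ)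
Nest (∀′ Φ)   = map (all ∷_) (Nest Φ)

alternations : List Quantifier → ℕ
alternations []              = 0
alternations (q ∷ [])        = 0
alternations (ex  ∷ ex  ∷ w) = alternations (ex ∷ w)
alternations (ex  ∷ all ∷ w) = suc (alternations (all ∷ w))
alternations (all ∷ ex  ∷ w) = suc (alternations (ex ∷ w))
alternations (all ∷ all ∷ w) = alternations (all ∷ w)

-- Nest Φ is never empty, so the default value 0 of max does not matter.

quantifierRank : ∀ {k} → Formula k → ℕ
quantifierRank Φ = max 0 (map length (Nest Φ))

alternationNumber : ∀ {k} → Formula k → ℕ
alternationNumber Φ = max 0 (map alternations (Nest Φ))

-- D₀(G,G′) is a minimum over infinitely many formulas, and it exists only if
-- some formula distinguishes the graphs, so it is a relation, not a function:
-- IsD₀ G G′ d says that the minimum exists and equals d.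

record IsD₀ {m n : ℕ} (G : Graph m) (G′ : Graph n) (d : ℕ) : Set where
  field
    attained : ∃[ Φ ] (alternationNumber Φ ≡ 0 × Distinguishes Φ G G′ × quantifierRank Φ ≡ d)
    minimal  : ∀ Φ → alternationNumber Φ ≡ 0 → Distinguishes Φ G G′ → d ≤ quantifierRank Φ

-- A formula without quantifier alternation is a Boolean combination of purely
-- existential and purely universal ones, so it suffices that Spoiler wins an
-- Ehrenfeucht game in which he stays in one graph of his choice for all
-- R = ⌊(n + 5)/2⌋ rounds.  Suppose that he does not.
--
-- The type of a vertex over a k-tuple x records its equalities and adjacencies
-- with x.  Extend x as long as one of the graphs has a k-tuple over which at
-- least 2k + 1 types are realised; then k + 2 ≤ R.  Survival of the remaining
-- R − k rounds is a preorder on tuples, so x can be replaced by tuples of G and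
-- G′ that are equivalent in both directions and still realise the same types.  If
-- a vertex u that shares its type were adjacent to some but not all of the other
-- vertices of some type, then adding u to x would create two new types.  So at
-- the end every such u is homogeneous to every type class, and adjacency is
-- determined by labels: the type together with the adjacencies to the vertices
-- that are alone in their type.  If all labels occur equally often in both graphs,
-- these are isomorphic.  Otherwise label a occurs more often in G than in G′, and
-- label c more often in G′ than in G.  Spoiler exposes this in one round more than
-- the number of vertices he has to select, and there are too few vertices
-- outside the other 2k − 1 types for both selections to exceed the R − k rounds.

module Submission where

open import Defs
open import Data.Bool.Base using (Bool; true; false)
import Data.Bool.Properties as Boolₚ
open import Data.Fin.Base as Fin using (Fin; zero; suc; toℕ; fromℕ<; punchIn; inject≤; funToFin; finToFun)
open import Data.Fin.Permutation as Perm using (Permutation; _⟨$⟩ʳ_; insert; insert-punchIn)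
open import Data.Fin.Properties as Finₚ
  using (all?; any?; pigeonhole; injective⇒≤; finToFun-funToFin; inject≤-injective; ¬∀⟶∃¬; ¬∀⟶∃¬-smallest)
open import Data.List.Base as List using (List; []; _∷_; length; filter; allFin)
open import Data.List.Extrema.Nat using (xs≤max; max≤v⁺)
open import Data.List.Membership.Propositional using (_∈_)
open import Data.List.Membership.Propositional.Properties
  using (∈-map⁺; ∈-++⁺ˡ; ∈-++⁻; ∈-filter⁺; ∈-filter⁻; ∈-lookup; ∈-allFin)
open import Data.List.Membership.Setoid.Properties using (index-injective)
open import Data.List.Properties
  using (length-map; length-++; filter-all; filter-none; filter-some)
open import Data.List.Relation.Binary.Permutation.Propositional
  using (_↭_; ↭-refl; ↭-prep; ↭-swap; ↭-trans)
open import Data.List.Relation.Binary.Permutation.Propositional.Properties using (↭-length; filter-↭)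
open import Data.List.Relation.Unary.All as All using (All; []; _∷_)
import Data.List.Relation.Unary.All.Properties as Allₚ
open import Data.List.Relation.Unary.AllPairs as AllPairs using (AllPairs; []; _∷_)
import Data.List.Relation.Unary.AllPairs.Properties as AllPairsₚ
open import Data.List.Relation.Unary.Any as Any using (here; there)
open import Data.List.Relation.Unary.Unique.Propositional using (Unique)
import Data.List.Relation.Unary.Unique.Propositional.Properties as Uniqueₚ
open import Data.Nat.Base as ℕ using (ℕ; zero; suc; _+_; _*_; _^_; _≤_; _<_; z≤n; s≤s; ⌊_/2⌋; ⌈_/2⌉)
open import Data.Nat.GeneralisedArithmetic using (fold)
import Data.Nat.Properties as ℕₚ
open import Data.Nat.Solver using (module +-*-Solver)
open import Data.Product.Base using (Σ-syntax; ∃-syntax; _×_; _,_; proj₁; proj₂)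
open import Data.Product.Properties using (≡-dec)
open import Data.Sum.Base using (_⊎_; inj₁; inj₂)
open import Data.Unit.Base using (⊤; tt)
open import Data.Vec.Base as Vec using (Vec; []; _∷_; _++_; lookup; map)
import Data.Vec.Properties as Vecₚ
open import Function.Base using (_∘_; id; _on_)
open import Function.Bundles using (_⇔_; mk⇔; module Equivalence; module Injection; module Inverse)
open import Function.Properties.Inverse using (↔⇒↣; ↔-sym)
open import Relation.Binary.Definitions using (DecidableEquality)
open import Relation.Binary.PropositionalEquality
  using (_≡_; _≢_; refl; sym; trans; cong; cong₂; subst; subst₂; setoid)
open import Relation.Nullary.Decidable
  using (Dec; yes; no; does; ¬?; _×-dec_; _→-dec_; dec-false; does-⇔; decidable-stable)
open import Relation.Nullary.Negation using (¬_; contradiction)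

open Graph using (Adj?; Adj-sym; Adj-irrefl)

-- Types of vertices and the one-sided game

transport-does : ∀ {A B : Set} (a? : Dec A) (b? : Dec B) → does a? ≡ does b? → A → B
transport-does (yes _) (yes b) _ _ = b
transport-does (no ¬a) _       _ a = contradiction a ¬a

Type : ℕ → Set
Type k = Vec (Bool × Bool) k

infix 4 _≟ᵗ_

_≟ᵗ_ : ∀ {k} → DecidableEquality (Type k)
_≟ᵗ_ = Vecₚ.≡-dec (≡-dec Boolₚ._≟_ Boolₚ._≟_)

-- Abstract, so that graphs and vertices can be inferred from equations of bits.

abstract
  bits : ∀ {n} → Graph n → Fin n → Fin n → Bool × Bool
  bits G v a = does (v Finₚ.≟ a) , does (Adj? G v a)

  bits-≡ : ∀ {m n} (G : Graph m) (G′ : Graph n) {u v u′ v′} →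
           bits G u v ≡ bits G′ u′ v′ → u ≡ v → u′ ≡ v′
  bits-≡ G G′ {u} {v} {u′} {v′} eq = transport-does (u Finₚ.≟ v) (u′ Finₚ.≟ v′) (cong proj₁ eq)

  bits-Adj : ∀ {m n} (G : Graph m) (G′ : Graph n) {u v u′ v′} →
             bits G u v ≡ bits G′ u′ v′ → Adj G u v → Adj G′ u′ v′
  bits-Adj G G′ {u} {v} {u′} {v′} eq = transport-does (Adj? G u v) (Adj? G′ u′ v′) (cong proj₂ eq)

  bits-cong : ∀ {m n} (G : Graph m) (G′ : Graph n) {u v u′ v′} →
              u ≡ v ⇔ u′ ≡ v′ → Adj G u v ⇔ Adj G′ u′ v′ → bits G u v ≡ bits G′ u′ v′
  bits-cong G G′ {u} {v} {u′} {v′} e a =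
    cong₂ _,_ (does-⇔ e (u Finₚ.≟ v) (u′ Finₚ.≟ v′)) (does-⇔ a (Adj? G u v) (Adj? G′ u′ v′))

typ : ∀ {n k} → Graph n → Vec (Fin n) k → Fin n → Type k
typ G x v = map (bits G v) x

bits-sym : ∀ {m n} (G : Graph m) (G′ : Graph n) {u v u′ v′} →
           bits G u v ≡ bits G′ u′ v′ → bits G v u ≡ bits G′ v′ u′
bits-sym G G′ eq = bits-cong G G′
  (mk⇔ (sym ∘ bits-≡ G G′ eq ∘ sym) (sym ∘ bits-≡ G′ G (sym eq) ∘ sym))
  (mk⇔ (Adj-sym G′ ∘ bits-Adj G G′ eq ∘ Adj-sym G) (Adj-sym G ∘ bits-Adj G′ G (sym eq) ∘ Adj-sym G′))

bits-refl : ∀ {m n} (G : Graph m) (G′ : Graph n) v v′ → bits G v v ≡ bits G′ v′ v′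
bits-refl G G′ v v′ = bits-cong G G′
  (mk⇔ (λ _ → refl) (λ _ → refl))
  (mk⇔ (λ a → contradiction a (Adj-irrefl G refl)) (λ a → contradiction a (Adj-irrefl G′ refl)))

typ-bits : ∀ {m n k} {G : Graph m} {G′ : Graph n} (x : Vec (Fin m) k) (x′ : Vec (Fin n) k) {v v′} →
           typ G x v ≡ typ G′ x′ v′ → ∀ i → bits G v (lookup x i) ≡ bits G′ v′ (lookup x′ i)
typ-bits (a ∷ x) (a′ ∷ x′) eq zero    = Vecₚ.∷-injectiveˡ eq
typ-bits (a ∷ x) (a′ ∷ x′) eq (suc i) = typ-bits x x′ (Vecₚ.∷-injectiveʳ eq) i

PartialIso : ∀ {m n k} → Graph m → Graph n → Vec (Fin m) k → Vec (Fin n) k → Set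
PartialIso G G′ []      []        = ⊤
PartialIso G G′ (v ∷ x) (v′ ∷ x′) = typ G x v ≡ typ G′ x′ v′ × PartialIso G G′ x x′

-- Duplicator can survive r rounds of the Ehrenfeucht game in which Spoiler
-- always moves in G; unlike PartialIso, this says nothing about x and x′ themselves.

Survives : ∀ {m n k} → ℕ → Graph m → Graph n → Vec (Fin m) k → Vec (Fin n) k → Set
Survives zero    G G′ x x′ = ⊤
Survives (suc r) G G′ x x′ =
  ∀ v → ∃[ v′ ] (typ G x v ≡ typ G′ x′ v′ × Survives r G G′ (v ∷ x) (v′ ∷ x′))

Below : ∀ {m n k} → ℕ → Graph m → Graph n → Vec (Fin m) k → Vec (Fin n) k → Set
Below r G G′ x x′ = PartialIso G G′ x x′ × Survives r G G′ x x′

survives? : ∀ {m n k} r (G : Graph m) (G′ : Graph n) (x : Vec (Fin m) k) (x′ : Vec (Fin n) k) →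
            Dec (Survives r G G′ x x′)
survives? zero    G G′ x x′ = yes tt
survives? (suc r) G G′ x x′ =
  all? λ v → any? λ v′ → (typ G x v ≟ᵗ typ G′ x′ v′) ×-dec survives? r G G′ (v ∷ x) (v′ ∷ x′)

-- `PartialIso` compares each vertex only with those placed before it. The reversed pairs follow by
-- symmetry, and the diagonal because adjacency is irreflexive.
partialIso-bits : ∀ {m n k} {G : Graph m} {G′ : Graph n} (x : Vec (Fin m) k) (x′ : Vec (Fin n) k) →
                  PartialIso G G′ x x′ →
                  ∀ i j → bits G (lookup x i) (lookup x j) ≡ bits G′ (lookup x′ i) (lookup x′ j)
partialIso-bits {G = G} {G′} (v ∷ x) (v′ ∷ x′) p zero    zero    = bits-refl G G′ v v′
partialIso-bits (v ∷ x) (v′ ∷ x′) p zero    (suc j) = typ-bits x x′ (proj₁ p) j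
partialIso-bits {G = G} {G′} (v ∷ x) (v′ ∷ x′) p (suc i) zero =
  bits-sym G G′ (typ-bits x x′ (proj₁ p) i)
partialIso-bits (v ∷ x) (v′ ∷ x′) p (suc i) (suc j) = partialIso-bits x x′ (proj₂ p) i j

below-refl : ∀ {n k} r (G : Graph n) (x : Vec (Fin n) k) → Below r G G x x
below-refl r G x = partialIso-refl x , survives-refl r x
  where
  partialIso-refl : ∀ {k} (x : Vec _ k) → PartialIso G G x x
  partialIso-refl []      = tt
  partialIso-refl (v ∷ x) = refl , partialIso-refl x

  survives-refl : ∀ {k} r (x : Vec _ k) → Survives r G G x x
  survives-refl zero    x = tt
  survives-refl (suc r) x = λ v → v , refl , survives-refl r (v ∷ x)

below-trans : ∀ {l m n k} r {G : Graph l} {H : Graph m} {K : Graph n}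
              {x : Vec (Fin l) k} {y : Vec (Fin m) k} {z : Vec (Fin n) k} →
              Below r G H x y → Below r H K y z → Below r G K x z
below-trans r {G} {H} {K} {x} {y} {z} (p , s) (q , t) =
  partialIso-trans x y z p q , survives-trans r x y z s t
  where
  partialIso-trans : ∀ {k} (x : Vec _ k) (y : Vec _ k) (z : Vec _ k) →
                     PartialIso G H x y → PartialIso H K y z → PartialIso G K x z
  partialIso-trans []      []      []      _       _       = tt
  partialIso-trans (_ ∷ x) (_ ∷ y) (_ ∷ z) (e , p) (f , q) = trans e f , partialIso-trans x y z p q

  survives-trans : ∀ {k} r (x : Vec _ k) (y : Vec _ k) (z : Vec _ k) →
                   Survives r G H x y → Survives r H K y z → Survives r G K x z
  survives-trans zero    x y z s t   = tt
  survives-trans (suc r) x y z s t u with s u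
  ... | v , e , s′ with t v
  ...   | w , f , t′ = w , trans e f , survives-trans r (u ∷ x) (v ∷ y) (w ∷ z) s′ t′

-- Formulas and the game

Uniform : ∀ {k} → Quantifier → ℕ → Formula k → Set
Uniform q r Φ = All (λ w → All (q ≡_) w × length w ≤ r) (Nest Φ)

exchange-involutive : ∀ q → exchange (exchange q) ≡ q
exchange-involutive ex  = refl
exchange-involutive all = refl

uniform-¬ : ∀ {k q r} {Φ : Formula k} → Uniform q r (¬′ Φ) → Uniform (exchange q) r Φ
uniform-¬ {q = q} {r} h = All.map
  (λ { {w} (u , l) → All.map (λ e → trans (cong exchange e) (exchange-involutive _)) (Allₚ.map⁻ u)
                   , subst (_≤ r) (length-map exchange w) l })
  (Allₚ.map⁻ h)

-- With an empty `Nest Φ`, uniformity of a quantified formula would hold vacuously and determine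
-- neither its first quantifier nor a positive rank.
nest-inhabited : ∀ {k} (Φ : Formula k) → ∃[ w ] w ∈ Nest Φ
nest-inhabited (E′ x y) = [] , here refl
nest-inhabited (x ≈′ y) = [] , here refl
nest-inhabited (¬′ Φ)   = _ , ∈-map⁺ _ (proj₂ (nest-inhabited Φ))
nest-inhabited (Φ ∧′ Ψ) = _ , ∈-++⁺ˡ (proj₂ (nest-inhabited Φ))
nest-inhabited (Φ ∨′ Ψ) = _ , ∈-++⁺ˡ (proj₂ (nest-inhabited Φ))
nest-inhabited (∃′ Φ)   = _ , ∈-map⁺ _ (proj₂ (nest-inhabited Φ))
nest-inhabited (∀′ Φ)   = _ , ∈-map⁺ _ (proj₂ (nest-inhabited Φ))

uniform-head : ∀ {k q q′ r} (Φ : Formula k) →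
               All (λ w → All (q ≡_) w × length w ≤ r) (List.map (q′ ∷_) (Nest Φ)) →
               q ≡ q′ × ∃[ r′ ] (r ≡ suc r′ × Uniform q r′ Φ)
uniform-head {r = r} Φ h with All.lookup (Allₚ.map⁻ h) (proj₂ (nest-inhabited Φ))
uniform-head {r = suc r} Φ h | e ∷ _ , s≤s _ =
  e , r , refl , All.map (λ { (_ ∷ u , s≤s l) → u , l }) (Allₚ.map⁻ h)

-- An existential witness in `G` is a move of Spoiler, and Duplicator's reply is the witness in
-- `G′`. Negation exchanges the quantifiers and reverses the implication, hence the simultaneous
-- induction with `reflect`.
preserve : ∀ {m n k} r {G : Graph m} {G′ : Graph n} {x : Vec (Fin m) k} {x′ : Vec (Fin n) k} Φ →
           Uniform ex r Φ → Below r G G′ x x′ → Sat G x Φ → Sat G′ x′ Φ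
reflect  : ∀ {m n k} r {G : Graph m} {G′ : Graph n} {x : Vec (Fin m) k} {x′ : Vec (Fin n) k} Φ →
           Uniform all r Φ → Below r G G′ x x′ → Sat G′ x′ Φ → Sat G x Φ

preserve r {G} {G′} {x} {x′} (E′ i j) h (p , s) a = bits-Adj G G′ (partialIso-bits x x′ p i j) a
preserve r {G} {G′} {x} {x′} (i ≈′ j) h (p , s) a =
  bits-≡ G G′ (partialIso-bits x x′ p i j) a
preserve r (¬′ Φ) h b ¬a a′ = ¬a (reflect r Φ (uniform-¬ {Φ = Φ} h) b a′)
preserve r (Φ ∧′ Ψ) h b (a , c) =
  preserve r Φ (Allₚ.++⁻ˡ (Nest Φ) h) b a , preserve r Ψ (Allₚ.++⁻ʳ (Nest Φ) h) b c
preserve r (Φ ∨′ Ψ) h b (inj₁ a) = inj₁ (preserve r Φ (Allₚ.++⁻ˡ (Nest Φ) h) b a)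
preserve r (Φ ∨′ Ψ) h b (inj₂ c) = inj₂ (preserve r Ψ (Allₚ.++⁻ʳ (Nest Φ) h) b c)
preserve r (∃′ Φ) h (p , s) (v , a) with uniform-head Φ h
... | _ , r′ , refl , h′ with s v
...   | v′ , e , s′ = v′ , preserve r′ Φ h′ ((e , p) , s′) a
preserve r (∀′ Φ) h b a with uniform-head Φ h
... | () , _

reflect r {G} {G′} {x} {x′} (E′ i j) h (p , s) a = bits-Adj G′ G (sym (partialIso-bits x x′ p i j)) a
reflect r {G} {G′} {x} {x′} (i ≈′ j) h (p , s) a =
  bits-≡ G′ G (sym (partialIso-bits x x′ p i j)) a
reflect r (¬′ Φ) h b ¬a a′ = ¬a (preserve r Φ (uniform-¬ {Φ = Φ} h) b a′)
reflect r (Φ ∧′ Ψ) h b (a , c) =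
  reflect r Φ (Allₚ.++⁻ˡ (Nest Φ) h) b a , reflect r Ψ (Allₚ.++⁻ʳ (Nest Φ) h) b c
reflect r (Φ ∨′ Ψ) h b (inj₁ a) = inj₁ (reflect r Φ (Allₚ.++⁻ˡ (Nest Φ) h) b a)
reflect r (Φ ∨′ Ψ) h b (inj₂ c) = inj₂ (reflect r Ψ (Allₚ.++⁻ʳ (Nest Φ) h) b c)
reflect r (∃′ Φ) h b a with uniform-head Φ h
... | () , _
reflect r (∀′ Φ) h (p , s) a v with uniform-head Φ h
... | _ , r′ , refl , h′ with s v
...   | v′ , e , s′ = reflect r′ Φ h′ ((e , p) , s′) (a v′)

alternations-uniform : ∀ q w → alternations (q ∷ w) ≡ 0 → All (q ≡_) (q ∷ w)
alternations-uniform q   []        _ = refl ∷ []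
alternations-uniform ex  (ex  ∷ w) e = refl ∷ alternations-uniform ex w e
alternations-uniform all (all ∷ w) e = refl ∷ alternations-uniform all w e

uniform-alternations : ∀ {q} w → All (q ≡_) w → alternations w ≡ 0
uniform-alternations         []            _                   = refl
uniform-alternations         (_   ∷ [])    _                   = refl
uniform-alternations {ex}    (_ ∷ _ ∷ w)   (refl ∷ refl ∷ u)   = uniform-alternations (ex ∷ w) (refl ∷ u)
uniform-alternations {all}   (_ ∷ _ ∷ w)   (refl ∷ refl ∷ u)   = uniform-alternations (all ∷ w) (refl ∷ u)

alternations-exchange : ∀ w → alternations (List.map exchange w) ≡ alternations w
alternations-exchange []              = refl
alternations-exchange (q ∷ [])        = refl
alternations-exchange (ex  ∷ ex  ∷ w) = alternations-exchange (ex ∷ w)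
alternations-exchange (ex  ∷ all ∷ w) = cong suc (alternations-exchange (all ∷ w))
alternations-exchange (all ∷ ex  ∷ w) = cong suc (alternations-exchange (ex ∷ w))
alternations-exchange (all ∷ all ∷ w) = alternations-exchange (all ∷ w)

AlternationFree : ∀ {k} → ℕ → Formula k → Set
AlternationFree r Φ = All (λ w → alternations w ≡ 0 × length w ≤ r) (Nest Φ)

-- Once the first letter of a word is fixed, absence of alternation forces all later letters to
-- equal it.
alternationFree-quantified : ∀ {r} q ws →
  All (λ w → alternations w ≡ 0 × length w ≤ r) (List.map (q ∷_) ws) →
  All (λ w → All (q ≡_) w × length w ≤ r) (List.map (q ∷_) ws)
alternationFree-quantified q ws h =
  Allₚ.map⁺ (All.map (λ { (e , l) → alternations-uniform q _ e , l }) (Allₚ.map⁻ h))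

-- Outermost existential subformulas are carried over by the first game and outermost universal ones
-- by the second. Negation swaps the two games.
agree : ∀ {m n k} r {G : Graph m} {G′ : Graph n} {x : Vec (Fin m) k} {x′ : Vec (Fin n) k} Φ →
        AlternationFree r Φ → Below r G G′ x x′ → Below r G′ G x′ x → Sat G x Φ → Sat G′ x′ Φ
agree r {G} {G′} {x} {x′} (E′ i j) h (p , s) b a = bits-Adj G G′ (partialIso-bits x x′ p i j) a
agree r {G} {G′} {x} {x′} (i ≈′ j) h (p , s) b a =
  bits-≡ G G′ (partialIso-bits x x′ p i j) a
agree r (¬′ Φ) h b b′ ¬a a′ = ¬a (agree r Φ h′ b′ b a′)
  where
  h′ : AlternationFree r Φ
  h′ = All.map (λ { {w} (e , l) → trans (sym (alternations-exchange w)) e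
                                , subst (_≤ r) (length-map exchange w) l })
       (Allₚ.map⁻ h)
agree r (Φ ∧′ Ψ) h b b′ (a , c) =
  agree r Φ (Allₚ.++⁻ˡ (Nest Φ) h) b b′ a , agree r Ψ (Allₚ.++⁻ʳ (Nest Φ) h) b b′ c
agree r (Φ ∨′ Ψ) h b b′ (inj₁ a) = inj₁ (agree r Φ (Allₚ.++⁻ˡ (Nest Φ) h) b b′ a)
agree r (Φ ∨′ Ψ) h b b′ (inj₂ c) = inj₂ (agree r Ψ (Allₚ.++⁻ʳ (Nest Φ) h) b b′ c)
agree r (∃′ Φ) h b b′ a = preserve r (∃′ Φ) (alternationFree-quantified ex (Nest Φ) h) b a
agree r (∀′ Φ) h b b′ a = reflect r (∀′ Φ) (alternationFree-quantified all (Nest Φ) h) b′ a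

Separates : ∀ {m n k} → Formula k → Graph m → Graph n → Vec (Fin m) k → Vec (Fin n) k → Set
Separates Φ G G′ x x′ = Sat G x Φ × ¬ Sat G′ x′ Φ

separate-bits : ∀ {m n k} (G : Graph m) (G′ : Graph n) (x : Vec (Fin m) k) (x′ : Vec (Fin n) k) i j →
                bits G (lookup x i) (lookup x j) ≢ bits G′ (lookup x′ i) (lookup x′ j) →
                ∃[ Φ ] (Uniform ex 0 Φ × Separates Φ G G′ x x′)
separate-bits G G′ x x′ i j ne
  with lookup x i Finₚ.≟ lookup x j | lookup x′ i Finₚ.≟ lookup x′ j
     | Adj? G (lookup x i) (lookup x j) | Adj? G′ (lookup x′ i) (lookup x′ j)
... | yes e | no ¬e | _     | _     = i ≈′ j , ([] , z≤n) ∷ [] , e , ¬e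
... | no ¬e | yes e | _     | _     = ¬′ (i ≈′ j) , ([] , z≤n) ∷ [] , ¬e , λ ¬e′ → ¬e′ e
... | _     | _     | yes a | no ¬a = E′ i j , ([] , z≤n) ∷ [] , a , ¬a
... | _     | _     | no ¬a | yes a = ¬′ (E′ i j) , ([] , z≤n) ∷ [] , ¬a , λ ¬a′ → ¬a′ a
... | yes e | yes e′ | yes a | yes a′ =
  contradiction (bits-cong G G′ (mk⇔ (λ _ → e′) (λ _ → e)) (mk⇔ (λ _ → a′) (λ _ → a))) ne
... | yes e | yes e′ | no ¬a | no ¬a′ =
  contradiction (bits-cong G G′ (mk⇔ (λ _ → e′) (λ _ → e)) (mk⇔ (λ a → contradiction a ¬a) (λ a → contradiction a ¬a′))) ne
... | no ¬e | no ¬e′ | yes a | yes a′ =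
  contradiction (bits-cong G G′ (mk⇔ (λ e → contradiction e ¬e) (λ e → contradiction e ¬e′)) (mk⇔ (λ _ → a′) (λ _ → a))) ne
... | no ¬e | no ¬e′ | no ¬a | no ¬a′ =
  contradiction (bits-cong G G′ (mk⇔ (λ e → contradiction e ¬e) (λ e → contradiction e ¬e′)) (mk⇔ (λ a → contradiction a ¬a) (λ a → contradiction a ¬a′))) ne

typ-≢ : ∀ {m n k} (G : Graph m) (G′ : Graph n) (x : Vec (Fin m) k) (x′ : Vec (Fin n) k) v v′ →
        typ G x v ≢ typ G′ x′ v′ → ∃[ i ] bits G v (lookup x i) ≢ bits G′ v′ (lookup x′ i)
typ-≢ G G′ []      []        v v′ ne = contradiction refl ne
typ-≢ G G′ (a ∷ x) (a′ ∷ x′) v v′ ne with ≡-dec Boolₚ._≟_ Boolₚ._≟_ (bits G v a) (bits G′ v′ a′)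
... | no  ne′ = zero , ne′
... | yes e   with typ-≢ G G′ x x′ v v′ (ne ∘ cong₂ _∷_ e)
...   | i , ne′ = suc i , ne′

-- At least one variable is in scope, so that `zero ≈′ zero` can serve as the true formula for the
-- empty conjunction.
⋀ : ∀ {k} m → (Fin m → Formula (suc k)) → Formula (suc k)
⋀ zero    Φ = zero ≈′ zero
⋀ (suc m) Φ = Φ zero ∧′ ⋀ m (Φ ∘ suc)

⋀-uniform : ∀ {k q r} m (Φ : Fin m → Formula (suc k)) → (∀ i → Uniform q r (Φ i)) → Uniform q r (⋀ m Φ)
⋀-uniform zero    Φ h = ([] , z≤n) ∷ []
⋀-uniform (suc m) Φ h = Allₚ.++⁺ (h zero) (⋀-uniform m (Φ ∘ suc) (h ∘ suc))

⋀-intro : ∀ {n k} {G : Graph n} {x : Vec (Fin n) (suc k)} m Φ → (∀ i → Sat G x (Φ i)) → Sat G x (⋀ m Φ)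
⋀-intro zero    Φ h = refl
⋀-intro (suc m) Φ h = h zero , ⋀-intro m (Φ ∘ suc) (h ∘ suc)

⋀-elim : ∀ {n k} {G : Graph n} {x : Vec (Fin n) (suc k)} m Φ → Sat G x (⋀ m Φ) → ∀ i → Sat G x (Φ i)
⋀-elim (suc m) Φ (a , _) zero    = a
⋀-elim (suc m) Φ (_ , a) (suc i) = ⋀-elim m (Φ ∘ suc) a i

-- Spoiler's winning move becomes the witness of an existential quantifier. The conjunction below it
-- refutes every possible reply: by induction if the types agree, and otherwise without quantifiers.
separate : ∀ {m n k} r (G : Graph m) (G′ : Graph n) (x : Vec (Fin m) k) (x′ : Vec (Fin n) k) →
           ¬ Survives r G G′ x x′ → ∃[ Φ ] (Uniform ex r Φ × Separates Φ G G′ x x′)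
separate zero    G G′ x x′ ¬s = contradiction tt ¬s
separate {m} {n} {k} (suc r) G G′ x x′ ¬s with ¬∀⟶∃¬ m _ answer? ¬s
  where
  answer? = λ v → any? λ v′ → (typ G x v ≟ᵗ typ G′ x′ v′) ×-dec survives? r G G′ (v ∷ x) (v′ ∷ x′)
... | v , ¬answer =
  ∃′ ⋀ n (λ v′ → proj₁ (refute v′))
  , Allₚ.map⁺ (All.map (λ { (u , l) → refl ∷ u , s≤s l }) (⋀-uniform n _ λ v′ → proj₁ (proj₂ (refute v′))))
  , (v , ⋀-intro n _ λ v′ → proj₁ (proj₂ (proj₂ (refute v′))))
  , λ { (v′ , a) → proj₂ (proj₂ (proj₂ (refute v′))) (⋀-elim n _ a v′) }
  where
  refute : ∀ v′ → ∃[ Φ ] (Uniform ex r Φ × Separates Φ G G′ (v ∷ x) (v′ ∷ x′))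
  refute v′ with typ G x v ≟ᵗ typ G′ x′ v′
  ... | yes e = separate r G G′ (v ∷ x) (v′ ∷ x′) λ s → ¬answer (v′ , e , s)
  ... | no ne with typ-≢ G G′ x x′ v v′ ne
  ...   | i , ne′ with separate-bits G G′ (v ∷ x) (v′ ∷ x′) zero (suc i) ne′
  ...     | Φ , h , sep = Φ , All.map (λ { (u , l) → u , ℕₚ.≤-trans l z≤n }) h , sep

-- Counting with labels

lookup-unique : ∀ {A : Set} {xs : List A} → Unique xs →
                ∀ {i j} → List.lookup xs i ≡ List.lookup xs j → i ≡ j
lookup-unique (_ ∷ _)  {zero}  {zero}  _ = refl
lookup-unique (p ∷ _)  {zero}  {suc j} e = contradiction e (All.lookup p (∈-lookup j))
lookup-unique (p ∷ _)  {suc i} {zero}  e = contradiction (sym e) (All.lookup p (∈-lookup i))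
lookup-unique (_ ∷ ps) {suc i} {suc j} e = cong suc (lookup-unique ps e)

unique-length : ∀ {n} {xs : List (Fin n)} → Unique xs → length xs ≤ n
unique-length u = injective⇒≤ (lookup-unique u)

module _ {A : Set} (_≟_ : DecidableEquality A) where

  count : ∀ {n} → (Fin n → A) → A → ℕ
  count ℓ a = length (filter (_≟ a) (List.tabulate ℓ))

  class : ∀ {n} → (Fin n → A) → A → List (Fin n)
  class ℓ a = filter (λ v → ℓ v ≟ a) (allFin _)

  length-class : ∀ {n} (ℓ : Fin n → A) a → length (class ℓ a) ≡ count ℓ a
  length-class ℓ a = go id
    where
    go : ∀ {m} (f : Fin m → Fin _) →
         length (filter (λ v → ℓ v ≟ a) (List.tabulate f)) ≡ length (filter (_≟ a) (List.tabulate (ℓ ∘ f)))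
    go {zero}  f = refl
    go {suc m} f with does (ℓ (f zero) ≟ a)
    ... | true  = cong suc (go (f ∘ suc))
    ... | false = go (f ∘ suc)

  class-unique : ∀ {n} (ℓ : Fin n → A) a → Unique (class ℓ a)
  class-unique ℓ a = Uniqueₚ.filter⁺ (λ v → ℓ v ≟ a) (Uniqueₚ.allFin⁺ _)

  ∈-class : ∀ {n} (ℓ : Fin n → A) {a v} → ℓ v ≡ a → v ∈ class ℓ a
  ∈-class ℓ {a} e = ∈-filter⁺ (λ v → ℓ v ≟ a) (∈-allFin _) e

  class-∈ : ∀ {n} (ℓ : Fin n → A) {a v} → v ∈ class ℓ a → ℓ v ≡ a
  class-∈ ℓ {a} v∈ = proj₂ (∈-filter⁻ (λ v → ℓ v ≟ a) {xs = allFin _} v∈)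

  members : ∀ {n m} (ℓ : Fin n → A) a → m ≤ count ℓ a →
            ∃[ ws ] (∀ {i j} → lookup {n = m} ws i ≡ lookup ws j → i ≡ j) × (∀ i → ℓ (lookup ws i) ≡ a)
  members ℓ a m≤ = Vec.tabulate w
    , (λ {i} {j} e → inject≤-injective _ _ i j (lookup-unique (class-unique ℓ a)
                       (trans (sym (Vecₚ.lookup∘tabulate w i)) (trans e (Vecₚ.lookup∘tabulate w j)))))
    , λ i → trans (cong ℓ (Vecₚ.lookup∘tabulate w i)) (class-∈ ℓ (∈-lookup {xs = class ℓ a} _))
    where
    w : Fin _ → Fin _
    w i = List.lookup (class ℓ a) (inject≤ i (subst (_ ≤_) (sym (length-class ℓ a)) m≤))

  injection-count : ∀ {n m} (ℓ : Fin n → A) a (ws : Vec (Fin n) m) →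
                    (∀ {i j} → lookup ws i ≡ lookup ws j → i ≡ j) → (∀ i → ℓ (lookup ws i) ≡ a) →
                    m ≤ count ℓ a
  injection-count ℓ a ws inj lab = subst (_ ≤_) (length-class ℓ a)
    (injective⇒≤ {f = λ i → Any.index (∈-class ℓ (lab i))}
      (λ {i} {j} e → inj (index-injective (setoid _) (∈-class ℓ (lab i)) (∈-class ℓ (lab j)) e)))

  tabulate-punchIn : ∀ {n} (ℓ : Fin (suc n) → A) j →
                     List.tabulate ℓ ↭ ℓ j ∷ List.tabulate (ℓ ∘ punchIn j)
  tabulate-punchIn         ℓ zero    = ↭-refl
  tabulate-punchIn {suc n} ℓ (suc j) = ↭-trans (↭-prep _ (tabulate-punchIn (ℓ ∘ suc) j)) (↭-swap _ _ ↭-refl)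

  -- Greedy matching: vertex `zero` is paired with some `j` of the same label, and removing both
  -- lowers the two counts of that label equally. If there is no such `j`, the label of `zero` is in
  -- excess.
  matching : ∀ {n} (ℓ ℓ′ : Fin n → A) →
             (Σ[ π ∈ Permutation n n ] ∀ v → ℓ′ (π ⟨$⟩ʳ v) ≡ ℓ v) ⊎ ∃[ a ] count ℓ′ a < count ℓ a
  matching {zero}  ℓ ℓ′ = inj₁ (Perm.id , λ ())
  matching {suc n} ℓ ℓ′ with any? (λ j → ℓ′ j ≟ ℓ zero)
  ... | no none = inj₂ (ℓ zero , subst (_< count ℓ (ℓ zero))
      (sym (cong length (filter-none (_≟ ℓ zero) (Allₚ.tabulate⁺ {f = ℓ′} (λ j e → none (j , e))))))
      (filter-some (_≟ ℓ zero) {List.tabulate ℓ} (here refl)))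
  ... | yes (j , e) with matching (ℓ ∘ suc) (ℓ′ ∘ punchIn j)
  ...   | inj₁ (π , match) = inj₁ (insert zero j π , match′)
    where
    match′ : ∀ v → ℓ′ (insert zero j π ⟨$⟩ʳ v) ≡ ℓ v
    match′ zero    = e
    match′ (suc v) = trans (cong ℓ′ (insert-punchIn zero j π v)) (match v)
  ...   | inj₂ (a , lt) = inj₂ (a ,
    subst (_< count ℓ a) (sym (↭-length (filter-↭ (_≟ a) (tabulate-punchIn ℓ′ j)))) lt′)
    where
    lt′ : length (filter (_≟ a) (ℓ′ j ∷ List.tabulate (ℓ′ ∘ punchIn j))) < count ℓ a
    lt′ rewrite e with does (ℓ zero ≟ a)
    ... | true  = s≤s lt
    ... | false = lt

Separated : {A B : Set} → (A → B) → List A → Set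
Separated f = AllPairs (_≢_ on f)

module _ {A B : Set} (_≟_ : DecidableEquality B) (f : A → B) where

  avoiding : B → List A → List A
  avoiding b = filter (λ a → ¬? (f a ≟ b))

  -- A separated list has at most one entry of value `b`, so the filter drops at most one.
  length-avoiding : ∀ b {xs} → Separated f xs → length xs ≤ suc (length (avoiding b xs))
  length-avoiding b [] = z≤n
  length-avoiding b {x ∷ xs} (p ∷ ps) with f x ≟ b
  ... | no  _ = s≤s (length-avoiding b ps)
  ... | yes e = s≤s (ℕₚ.≤-reflexive (sym (cong length
                  (filter-all (λ a → ¬? (f a ≟ b)) (All.map (λ ne e′ → ne (trans e (sym e′))) p)))))

  -- The representative of the `f`-class of `p`, if listed, is exchanged for `p` and `q`. The others
  -- stay separated because `g` refines `f`.
  split-class : ∀ {C : Set} (g : A → C) → (∀ {a b} → g a ≡ g b → f a ≡ f b) →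
                ∀ {p q} → f p ≡ f q → g p ≢ g q →
                ∀ {m} → ∃[ xs ] (Separated f xs × m ≤ length xs) →
                ∃[ xs ] (Separated g xs × suc m ≤ length xs)
  split-class g refines {p} {q} fp≡fq gp≢gq (xs , sep , m≤) = p ∷ q ∷ ys
    , ( (gp≢gq ∷ All.map (λ ne e → ne (sym (refines e))) ys≢)
      ∷ All.map (λ ne e → ne (trans (sym (refines e)) (sym fp≡fq))) ys≢
      ∷ AllPairs.map (λ ne e → ne (refines e)) (AllPairsₚ.filter⁺ _ sep))
    , s≤s (ℕₚ.≤-trans m≤ (length-avoiding (f p) sep))
    where
    ys = avoiding (f p) xs
    ys≢ = Allₚ.all-filter (λ a → ¬? (f a ≟ f p)) xs

-- The members of xs outside the f-classes of s and t, at least m − 2 of them, carry neither label.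

two-classes-bound : ∀ {n} {A B : Set} (_≟ᴬ_ : DecidableEquality A) (_≟ᴮ_ : DecidableEquality B)
  (ℓ : Fin n → A) (f : A → B) {s t} → s ≢ t →
  ∀ {m} → ∃[ xs ] (Separated (f ∘ ℓ) xs × m ≤ length xs) →
  count _≟ᴬ_ ℓ s + (count _≟ᴬ_ ℓ t + m) ≤ 2 + n
two-classes-bound {n} _≟ᴬ_ _≟ᴮ_ ℓ f {s} {t} s≢t {m} (xs , sep , m≤) = begin
  cₛ + (cₜ + m)                         ≤⟨ ℕₚ.+-monoʳ-≤ cₛ (ℕₚ.+-monoʳ-≤ cₜ m≤2+zs) ⟩
  cₛ + (cₜ + (2 + length zs))           ≡⟨ cong (cₛ +_) (ℕₚ.+-assoc cₜ 2 _) ⟨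
  cₛ + (cₜ + 2 + length zs)             ≡⟨ cong (λ c → cₛ + (c + length zs)) (ℕₚ.+-comm cₜ 2) ⟩
  cₛ + (2 + (cₜ + length zs))           ≡⟨ ℕₚ.+-assoc cₛ 2 _ ⟨
  cₛ + 2 + (cₜ + length zs)             ≡⟨ cong (_+ (cₜ + length zs)) (ℕₚ.+-comm cₛ 2) ⟩
  2 + (cₛ + (cₜ + length zs))           ≡⟨ cong (2 +_) (sym lengths) ⟩
  2 + length (S List.++ T List.++ zs)   ≤⟨ ℕₚ.+-monoʳ-≤ 2 (unique-length unique) ⟩
  2 + n                                 ∎
  where
  open ℕₚ.≤-Reasoning
  cₛ = count _≟ᴬ_ ℓ s
  cₜ = count _≟ᴬ_ ℓ t
  S = class _≟ᴬ_ ℓ s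
  T = class _≟ᴬ_ ℓ t
  ys = avoiding _≟ᴮ_ (f ∘ ℓ) (f s) xs
  zs = avoiding _≟ᴮ_ (f ∘ ℓ) (f t) ys

  ys-sep : Separated (f ∘ ℓ) ys
  ys-sep = AllPairsₚ.filter⁺ _ sep

  m≤2+zs : m ≤ 2 + length zs
  m≤2+zs = ℕₚ.≤-trans m≤ (ℕₚ.≤-trans (length-avoiding _≟ᴮ_ (f ∘ ℓ) (f s) sep)
             (s≤s (length-avoiding _≟ᴮ_ (f ∘ ℓ) (f t) ys-sep)))

  lengths : length (S List.++ T List.++ zs) ≡ cₛ + (cₜ + length zs)
  lengths = trans (length-++ S) (cong₂ _+_ (length-class _≟ᴬ_ ℓ s)
              (trans (length-++ T) (cong (_+ length zs) (length-class _≟ᴬ_ ℓ t))))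

  zs-avoid-s : ∀ {v} → v ∈ zs → f (ℓ v) ≢ f s
  zs-avoid-s v∈ = All.lookup (Allₚ.filter⁺ _ (Allₚ.all-filter (λ v → ¬? (f (ℓ v) ≟ᴮ f s)) xs)) v∈

  zs-avoid-t : ∀ {v} → v ∈ zs → f (ℓ v) ≢ f t
  zs-avoid-t v∈ = All.lookup (Allₚ.all-filter (λ v → ¬? (f (ℓ v) ≟ᴮ f t)) ys) v∈

  unique : Unique (S List.++ T List.++ zs)
  unique = Uniqueₚ.++⁺ (class-unique _≟ᴬ_ ℓ s)
    (Uniqueₚ.++⁺ (class-unique _≟ᴬ_ ℓ t)
      (AllPairs.map (λ ne e → ne (cong (f ∘ ℓ) e)) (AllPairsₚ.filter⁺ _ ys-sep))
      (λ (∈T , ∈zs) → zs-avoid-t ∈zs (cong f (class-∈ _≟ᴬ_ ℓ ∈T))))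
    (λ (∈S , ∈rest) → disjoint ∈S (∈-++⁻ T ∈rest))
    where
    disjoint : ∀ {v} → v ∈ S → v ∈ T ⊎ v ∈ zs → _
    disjoint ∈S (inj₁ ∈T)  = s≢t (trans (sym (class-∈ _≟ᴬ_ ℓ ∈S)) (class-∈ _≟ᴬ_ ℓ ∈T))
    disjoint ∈S (inj₂ ∈zs) = zs-avoid-s ∈zs (cong f (class-∈ _≟ᴬ_ ℓ ∈S))

-- Types over a tuple of vertices

Alone : ∀ {n k} → Graph n → Vec (Fin n) k → Fin n → Set
Alone G x y = ∀ w → typ G x w ≡ typ G x y → w ≡ y

alone? : ∀ {n k} (G : Graph n) (x : Vec (Fin n) k) y → Dec (Alone G x y)
alone? G x y = all? λ w → (typ G x w ≟ᵗ typ G x y) →-dec (w Finₚ.≟ y)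

¬alone : ∀ {n k} (G : Graph n) (x : Vec (Fin n) k) {y} → ¬ Alone G x y →
         ∃[ w ] (typ G x w ≡ typ G x y × w ≢ y)
¬alone G x {y} ¬a
  with ¬∀⟶∃¬ _ _ (λ w → (typ G x w ≟ᵗ typ G x y) →-dec (w Finₚ.≟ y)) ¬a
... | w , h = w , decidable-stable (typ G x w ≟ᵗ typ G x y) (λ ne → h λ e → contradiction e ne)
                , λ e → h λ _ → e

-- Two moves suffice: when Spoiler plays `y` and then `w`, both replies have the type of `y′`, so
-- both are `y′`, and equal replies come from equal moves.
alone-reflect : ∀ {n k r} (G G′ : Graph n) {x x′ : Vec (Fin n) k} → Survives (2 + r) G G′ x x′ →
                ∀ {y y′} → typ G x y ≡ typ G′ x′ y′ → Alone G′ x′ y′ → Alone G x y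
alone-reflect G G′ s {y} {y′} e alone w w≈y with s y
... | z , e₁ , s₁ with s₁ w
...   | u , e₂ , _ = bits-≡ G′ G (sym (Vecₚ.∷-injectiveˡ e₂)) (trans u≡y′ (sym z≡y′))
  where
  z≡y′ = alone z (trans (sym e₁) e)
  u≡y′ = alone u (trans (sym (Vecₚ.∷-injectiveʳ e₂)) (trans w≈y e))

-- `v` and `w` differ from `u`, since `u` is not adjacent to itself but may share their type.
Homogeneous : ∀ {n k} → Graph n → Vec (Fin n) k → Set
Homogeneous G x = ∀ u → ¬ Alone G x u → ∀ {v w} → v ≢ u → w ≢ u → typ G x v ≡ typ G x w →
                  Adj G u v → Adj G u w

-- Realised types are counted by representatives, which Duplicator's replies carry to the other
-- graph.
Rich : ∀ {n k} → Graph n → Vec (Fin n) k → ℕ → Set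
Rich G x m = ∃[ vs ] (Separated (typ G x) vs × m ≤ length vs)

rich-below : ∀ {n k r m} (G G′ : Graph n) {x x′ : Vec (Fin n) k} → Survives (suc r) G G′ x x′ →
             Rich G x m → Rich G′ x′ m
rich-below G G′ s (vs , sep , m≤) = List.map f vs
  , AllPairsₚ.map⁺ (AllPairs.map (λ ne e → ne (trans (typ-f _) (trans e (sym (typ-f _))))) sep)
  , subst (_ ≤_) (sym (length-map f vs)) m≤
  where
  f = λ v → proj₁ (s v)
  typ-f = λ v → proj₁ (proj₂ (s v))

rich-≤ : ∀ {n k m} (G : Graph n) (x : Vec (Fin n) k) → Rich G x m → m ≤ n
rich-≤ G x (vs , sep , m≤) =
  ℕₚ.≤-trans m≤ (unique-length (AllPairs.map (λ ne e → ne (cong (typ G x) e)) sep))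

-- The new vertex u leaves its class, which is not a singleton, and it splits
-- the common class of v and w.

rich-extend : ∀ {n k m} (G : Graph n) (x : Vec (Fin n) k) u → ¬ Alone G x u →
              ∀ v w → v ≢ u → w ≢ u → typ G x v ≡ typ G x w → Adj G u v → ¬ Adj G u w →
              Rich G x m → Rich G (u ∷ x) (2 + m)
rich-extend {n} {k} G x u ¬a v w v≢u w≢u v≈w uv ¬uw rich with ¬alone G x ¬a
... | u₂ , u₂≈u , u₂≢u =
  split-class (≡-dec Boolₚ._≟_ _≟ᵗ_) typ₁ (typ G (u ∷ x))
    (λ e → cong₂ _,_
      (does-⇔ (mk⇔ (bits-≡ G G (Vecₚ.∷-injectiveˡ e)) (bits-≡ G G (sym (Vecₚ.∷-injectiveˡ e))))
        (_ Finₚ.≟ u) (_ Finₚ.≟ u))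
      (Vecₚ.∷-injectiveʳ e))
    (cong₂ _,_ (trans (dec-false (v Finₚ.≟ u) v≢u) (sym (dec-false (w Finₚ.≟ u) w≢u))) v≈w)
    (λ e → ¬uw (Adj-sym G (bits-Adj G G (Vecₚ.∷-injectiveˡ e) (Adj-sym G uv))))
  (split-class _≟ᵗ_ (typ G x) typ₁ (cong proj₂) u₂≈u
    (λ e → u₂≢u (transport-does (u Finₚ.≟ u) (u₂ Finₚ.≟ u) (sym (cong proj₁ e)) refl))
    rich)
  where
  typ₁ : Fin n → Bool × Type k
  typ₁ a = does (a Finₚ.≟ u) , typ G x a

homogeneous-or-extend : ∀ {n k m} (G : Graph n) (x : Vec (Fin n) k) → Rich G x m →
                        Homogeneous G x ⊎ ∃[ u ] Rich G (u ∷ x) (2 + m)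
homogeneous-or-extend G x rich
  with any? (λ u → any? λ v → any? λ w →
         ¬? (alone? G x u) ×-dec ¬? (v Finₚ.≟ u) ×-dec ¬? (w Finₚ.≟ u) ×-dec
         (typ G x v ≟ᵗ typ G x w) ×-dec Adj? G u v ×-dec ¬? (Adj? G u w))
... | yes (u , v , w , ¬a , v≢u , w≢u , v≈w , uv , ¬uw) =
  inj₂ (u , rich-extend G x u ¬a v w v≢u w≢u v≈w uv ¬uw rich)
... | no none = inj₁ λ u ¬a {v} {w} v≢u w≢u v≈w uv →
  decidable-stable (Adj? G u w) λ ¬uw → none (u , v , w , ¬a , v≢u , w≢u , v≈w , uv , ¬uw)

-- Labels

Anchored : ∀ {n k} → Graph n → Vec (Fin n) k → Fin n → Type k → Set
Anchored G x v τ = ∃[ y ] (Alone G x y × typ G x y ≡ τ × Adj G v y)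

abstract
  anchored? : ∀ {n k} (G : Graph n) (x : Vec (Fin n) k) v τ → Dec (Anchored G x v τ)
  anchored? G x v τ = any? λ y → alone? G x y ×-dec (typ G x y ≟ᵗ τ) ×-dec Adj? G v y

Label : ℕ → ℕ → Set
Label k p = Type k × Vec Bool p

_≟ˡ_ : ∀ {k p} → DecidableEquality (Label k p)
_≟ˡ_ = ≡-dec _≟ᵗ_ (Vecₚ.≡-dec Boolₚ._≟_)

-- τs lists the types that can occur: this makes adjacency to the vertices
-- that are alone in their class comparable between the two graphs.

label : ∀ {n k p} → (Fin p → Type k) → (G : Graph n) → Vec (Fin n) k → Fin n → Label k p
label τs G x v = typ G x v , Vec.tabulate λ i → does (anchored? G x v (τs i))

label-anchored : ∀ {n k p} (τs : Fin p → Type k) (G G′ : Graph n) {x x′ : Vec (Fin n) k} {v v′} →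
                 label τs G x v ≡ label τs G′ x′ v′ →
                 ∀ i → Anchored G x v (τs i) → Anchored G′ x′ v′ (τs i)
label-anchored τs G G′ {x} {x′} {v} {v′} e i =
  transport-does (anchored? G x v (τs i)) (anchored? G′ x′ v′ (τs i))
    (trans (sym (Vecₚ.lookup∘tabulate _ i))
      (trans (cong (λ l → lookup (proj₂ l) i) e) (Vecₚ.lookup∘tabulate _ i)))

-- Playing several rounds

play : ∀ {n k j r} (G G′ : Graph n) {x x′ : Vec (Fin n) k} (ws : Vec (Fin n) j) →
       Below (j + r) G G′ x x′ → ∃[ ws′ ] Below r G G′ (ws ++ x) (ws′ ++ x′)
play G G′ [] b = [] , b
play {j = suc j} {r} G G′ {x} {x′} (w ∷ ws) (p , s)
  with play G G′ {x} {x′} ws (p , subst (λ i → Survives i G G′ x x′) (sym (ℕₚ.+-suc j r)) s)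
... | ws′ , p′ , s′ with s′ w
...   | w′ , e , s″ = w′ ∷ ws′ , (e , p′) , s″

-- Over the empty tuple, `play` would end at `x ++ []`, which is not definitionally `x`.
play₀ : ∀ {n k r} (G G′ : Graph n) (x : Vec (Fin n) k) →
        Survives (k + r) G G′ [] [] → ∃[ x′ ] Below r G G′ x x′
play₀ G G′ [] s = [] , tt , s
play₀ {k = suc k} {r} G G′ (v ∷ x) s
  with play₀ G G′ x (subst (λ i → Survives i G G′ [] []) (sym (ℕₚ.+-suc k r)) s)
... | x′ , p′ , s′ with s′ v
...   | v′ , e , s″ = v′ ∷ x′ , (e , p′) , s″

typ-++ : ∀ {n j k} (G : Graph n) (ws : Vec (Fin n) j) (x : Vec (Fin n) k) v →
         typ G (ws ++ x) v ≡ typ G ws v ++ typ G x v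
typ-++ G ws x v = Vecₚ.map-++ (bits G v) ws x

typ-++⁻ : ∀ {n j k} (G G′ : Graph n) {x x′ : Vec (Fin n) k} (ws ws′ : Vec (Fin n) j) {v v′} →
          typ G (ws ++ x) v ≡ typ G′ (ws′ ++ x′) v′ →
          typ G ws v ≡ typ G′ ws′ v′ × typ G x v ≡ typ G′ x′ v′
typ-++⁻ G G′ {x} {x′} ws ws′ e =
  Vecₚ.++-injective _ _ (trans (sym (typ-++ G ws x _)) (trans e (typ-++ G′ ws′ x′ _)))

partialIso-++⁻ : ∀ {n j k} (G G′ : Graph n) {x x′ : Vec (Fin n) k} (ws ws′ : Vec (Fin n) j) →
                 PartialIso G G′ (ws ++ x) (ws′ ++ x′) →
                 PartialIso G G′ ws ws′ × (∀ i → typ G x (lookup ws i) ≡ typ G′ x′ (lookup ws′ i))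
partialIso-++⁻ G G′ []       []         p       = tt , λ ()
partialIso-++⁻ G G′ {x} {x′} (w ∷ ws) (w′ ∷ ws′) (e , p)
  with typ-++⁻ G G′ {x} {x′} ws ws′ e | partialIso-++⁻ G G′ {x} {x′} ws ws′ p
... | e₁ , e₂ | q , f = (e₁ , q) , λ { zero → e₂ ; (suc i) → f i }

-- If a label occurs more often in G, then Spoiler selects in G one vertex more
-- than there are in G′; a reply of Duplicator with a different label is exposed
-- by one further move.

count-bound : ∀ {n k p r} (τs : Fin p → Type k) (G G′ : Graph n) {x x′ : Vec (Fin n) k} →
              Below (2 + r) G G′ x x′ → Below (2 + r) G′ G x′ x → ∀ a →
              count _≟ˡ_ (label τs G′ x′) a < count _≟ˡ_ (label τs G x) a →
              1 + r ≤ count _≟ˡ_ (label τs G′ x′) a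
count-bound {n} {k} {p} {r} τs G G′ {x} {x′} (pi , s) (_ , s′) a lt = ℕₚ.≮⇒≥ impossible
  where
  c = count _≟ˡ_ (label τs G′ x′) a

  module _ {ws ws′ : Vec (Fin n) (suc c)} (b : Below 1 G G′ (ws ++ x) (ws′ ++ x′)) where

    split = partialIso-++⁻ G G′ {x} {x′} ws ws′ (proj₁ b)

    reply : ∀ y → ∃[ z ] (typ G x y ≡ typ G′ x′ z × (∀ i → bits G y (lookup ws i) ≡ bits G′ z (lookup ws′ i)))
    reply y with proj₂ b y
    ... | z , e , _ with typ-++⁻ G G′ {x} {x′} ws ws′ e
    ...   | e₁ , e₂ = z , e₂ , typ-bits ws ws′ e₁

    forth : ∀ i τ → Anchored G x (lookup ws i) τ → Anchored G′ x′ (lookup ws′ i) τ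
    forth i τ (y , alone , y∶τ , adj) with reply y
    ... | z , e , bs = z , alone-reflect G′ G s′ (sym e) alone , trans (sym e) y∶τ
                         , Adj-sym G′ (bits-Adj G G′ (bs i) (Adj-sym G adj))

    -- Spoiler cannot move to `z`, which lies in `G′`. So `s′` supplies a `y` of the same type in
    -- `G`, and the reply to `y` must be `z` because `z` is alone in its type.
    back : ∀ i τ → Anchored G′ x′ (lookup ws′ i) τ → Anchored G x (lookup ws i) τ
    back i τ (z , alone , z∶τ , adj) with s′ z
    ... | y , z≈y , _ with reply y
    ...   | z₂ , e , bs with alone z₂ (trans (sym e) (sym z≈y))
    ...     | refl = y , alone-reflect G G′ s (sym z≈y) alone , trans (sym z≈y) z∶τ
                       , Adj-sym G (bits-Adj G′ G (sym (bs i)) (Adj-sym G′ adj))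

    label-preserved : ∀ i → label τs G′ x′ (lookup ws′ i) ≡ label τs G x (lookup ws i)
    label-preserved i = cong₂ _,_ (sym (proj₂ split i)) (Vecₚ.tabulate-cong λ t →
      does-⇔ (mk⇔ (back i (τs t)) (forth i (τs t))) (anchored? G′ x′ _ (τs t)) (anchored? G x _ (τs t)))

    injective-preserved : ∀ {i j} → lookup ws′ i ≡ lookup ws′ j → lookup ws i ≡ lookup ws j
    injective-preserved {i} {j} = bits-≡ G′ G (sym (partialIso-bits ws ws′ (proj₁ split) i j))

  impossible : ¬ c < 1 + r
  impossible c<1+r with ℕₚ.m≤n⇒∃[o]m+o≡n c<1+r | members _≟ˡ_ (label τs G x) a lt
  -- Selecting `suc c` vertices leaves `suc o` of the `2 + r` rounds, hence at least the one needed
  -- to compare labels. The replies would be `suc c` different vertices of label `a` in `G′`, which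
  -- has only `c`.
  ... | o , c+o≡r | ws , ws-inj , ws-lab with play G G′ {x} {x′} ws
          (pi , subst (λ i → Survives i G G′ x x′) (sym (trans (ℕₚ.+-suc (suc c) o) (cong suc c+o≡r))) s)
  ...   | ws′ , p′ , s″ = ℕₚ.1+n≰n (injection-count _≟ˡ_ (label τs G′ x′) a ws′
          (λ e → ws-inj (injective-preserved (p′ , one-round) e))
          (λ i → trans (label-preserved (p′ , one-round) i) (ws-lab i)))
    where
    one-round : Survives 1 G G′ (ws ++ x) (ws′ ++ x′)
    one-round v with s″ v
    ... | v′ , e , _ = v′ , e , tt

-- Isomorphism of homogeneous positions

-- If `u` or `v` is alone in its type, the label of the other one records the edge. Otherwise the
-- replies to `u` and `v` form an edge between the right types, and homogeneity of `G′` moves its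
-- ends to `u′` and `v′`.
same-label-Adj : ∀ {n k p r} (τs : Fin p → Type k) (G G′ : Graph n) {x x′ : Vec (Fin n) k} →
  Survives (2 + r) G G′ x x′ → Survives (2 + r) G′ G x′ x → Homogeneous G′ x′ →
  (∀ v → ∃[ i ] τs i ≡ typ G x v) →
  ∀ {u v u′ v′} → label τs G x u ≡ label τs G′ x′ u′ → label τs G x v ≡ label τs G′ x′ v′ →
  u ≢ v → u′ ≢ v′ → Adj G u v → Adj G′ u′ v′
same-label-Adj τs G G′ {x} {x′} s s′ hom occurs {u} {v} {u′} {v′} eu ev u≢v u′≢v′ uv
  = by-cases (alone? G x u) (alone? G x v)
  where
  typ-≡ : ∀ {w w′} → label τs G x w ≡ label τs G′ x′ w′ → typ G x w ≡ typ G′ x′ w′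
  typ-≡ = cong proj₁

  anchor : ∀ {y y′ w w′} → label τs G x y ≡ label τs G′ x′ y′ → label τs G x w ≡ label τs G′ x′ w′ →
           Alone G x y → Adj G w y → Adj G′ w′ y′
  anchor {y} {w′ = w′} ey ew alone wy with occurs y
  ... | i , τ≡ with label-anchored τs G G′ ew i (y , alone , sym τ≡ , wy)
  ...   | z , _ , z∶τ , wz = subst (Adj G′ w′)
    (alone-reflect G′ G s′ (sym (typ-≡ ey)) alone z (trans z∶τ (trans τ≡ (typ-≡ ey)))) wz

  ¬alone′ : ∀ {w w′} → typ G x w ≡ typ G′ x′ w′ → ¬ Alone G x w → ¬ Alone G′ x′ w′
  ¬alone′ e ¬a a = ¬a (alone-reflect G G′ s e a)

  by-cases : Dec (Alone G x u) → Dec (Alone G x v) → Adj G′ u′ v′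
  by-cases (yes au) _        = Adj-sym G′ (anchor eu ev au (Adj-sym G uv))
  by-cases _        (yes av) = anchor ev eu av uv
  by-cases (no ¬au) (no ¬av) with s u
  ... | u″ , e₁ , s₁ with s₁ v
  ...   | v″ , e₂ , _ = swing (v′ Finₚ.≟ u″)
    where
    u″≈u′ = trans (sym e₁) (typ-≡ eu)
    v″≈v′ = trans (sym (Vecₚ.∷-injectiveʳ e₂)) (typ-≡ ev)

    v″≢u″ : v″ ≢ u″
    v″≢u″ = u≢v ∘ sym ∘ bits-≡ G′ G (sym (Vecₚ.∷-injectiveˡ e₂))

    u″v″ : Adj G′ u″ v″
    u″v″ = Adj-sym G′ (bits-Adj G G′ (Vecₚ.∷-injectiveˡ e₂) (Adj-sym G uv))

    v′⇒ : ∀ {w} → w ≢ v′ → typ G′ x′ w ≡ typ G′ x′ u′ → Adj G′ v′ w → Adj G′ u′ v′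
    v′⇒ w≢v′ w≈u′ v′w = Adj-sym G′ (hom v′ (¬alone′ (typ-≡ ev) ¬av) w≢v′ u′≢v′ w≈u′ v′w)

    swing : Dec (v′ ≡ u″) → Adj G′ u′ v′
    swing (no v′≢u″) = v′⇒ (v′≢u″ ∘ sym) u″≈u′
      (Adj-sym G′ (hom u″ (¬alone′ e₁ ¬au) v″≢u″ v′≢u″ v″≈v′ u″v″))
    -- Now `v′` is itself an end of the edge and all vertices involved share one type, so a single
    -- exchange at `v′` is enough.
    swing (yes refl) = v′⇒ v″≢u″ (trans v″≈v′ u″≈u′) u″v″

≅-sym : ∀ {m n} {G : Graph m} {G′ : Graph n} → G ≅ G′ → G′ ≅ G
≅-sym {G = G} {G′} (f , f-Adj) = ↔-sym f , λ u v → mk⇔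
  (λ uv → Equivalence.from (f-Adj _ _) (subst₂ (Adj G′) (sym (to-from u)) (sym (to-from v)) uv))
  (λ uv → subst₂ (Adj G′) (to-from u) (to-from v) (Equivalence.to (f-Adj _ _) uv))
  where to-from = Inverse.strictlyInverseˡ f

matching-≅ : ∀ {n k p r} (τs : Fin p → Type k) (G G′ : Graph n) {x x′ : Vec (Fin n) k} →
  Survives (2 + r) G G′ x x′ → Survives (2 + r) G′ G x′ x → Homogeneous G x → Homogeneous G′ x′ →
  (∀ v → ∃[ i ] τs i ≡ typ G x v) → (∀ v → ∃[ i ] τs i ≡ typ G′ x′ v) →
  (π : Permutation n n) → (∀ v → label τs G′ x′ (π ⟨$⟩ʳ v) ≡ label τs G x v) → G ≅ G′
matching-≅ {n} τs G G′ s s′ hom hom′ occurs occurs′ π match = π , λ u v → mk⇔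
  (λ uv → same-label-Adj τs G G′ s s′ hom′ occurs
    (sym (match u)) (sym (match v)) (distinct G uv) (distinct G uv ∘ Injection.injective (↔⇒↣ π)) uv)
  (λ uv → same-label-Adj τs G′ G s′ s hom occurs′
    (match u) (match v) (distinct G′ uv) (distinct G′ uv ∘ cong (π ⟨$⟩ʳ_)) uv)
  where
  distinct : ∀ (H : Graph n) {u v} → Adj H u v → u ≢ v
  distinct H uv e = Adj-irrefl H e uv

-- If no label-preserving bijection exists, `a` is in excess in `G` and `c` in `G′`. Both are
-- counted in `G`: at least `2 + r` vertices for `a`, at least `1 + r` for `c`, and `2k − 1` of
-- further types, which is more than `bound` allows.
homogeneous-≅ : ∀ {n k r} (G G′ : Graph n) {x x′ : Vec (Fin n) k} →
  4 + n ≤ 2 * (k + (2 + r)) → Rich G x (1 + 2 * k) →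
  Below (2 + r) G G′ x x′ → Below (2 + r) G′ G x′ x →
  Homogeneous G x → Homogeneous G′ x′ → G ≅ G′
homogeneous-≅ {n} {k} {r} G G′ {x} {x′} bound rich b@(_ , s) b′@(_ , s′) hom hom′ =
  by-matching (matching _≟ˡ_ ℓ ℓ′) (matching _≟ˡ_ ℓ′ ℓ)
  where
  -- The vertices of `G` index the types. By `s′` these include all types realised in `G′`.
  ℓ = label (typ G x) G x
  ℓ′ = label (typ G x) G′ x′

  occurs : ∀ v → ∃[ i ] typ G x i ≡ typ G x v
  occurs v = v , refl

  occurs′ : ∀ v → ∃[ i ] typ G x i ≡ typ G′ x′ v
  occurs′ v = proj₁ (s′ v) , sym (proj₁ (proj₂ (s′ v)))

  excess : ∀ {a c} → count _≟ˡ_ ℓ′ a < count _≟ˡ_ ℓ a → count _≟ˡ_ ℓ c < count _≟ˡ_ ℓ′ c →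
           2 * (k + (2 + r)) ≤ 2 + n
  excess {a} {c} a< c< = begin
    2 * (k + (2 + r))                                          ≡⟨ rearrange k r ⟩
    (2 + r) + ((1 + r) + (1 + 2 * k))                          ≤⟨ ℕₚ.+-mono-≤ 2+r≤ (ℕₚ.+-monoˡ-≤ (1 + 2 * k) 1+r≤) ⟩
    count _≟ˡ_ ℓ a + (count _≟ˡ_ ℓ c + (1 + 2 * k))            ≤⟨ two-classes-bound _≟ˡ_ _≟ᵗ_ ℓ proj₁ a≢c rich ⟩
    2 + n                                                      ∎
    where
    open ℕₚ.≤-Reasoning
    2+r≤ = ℕₚ.≤-trans (s≤s (count-bound (typ G x) G G′ b b′ a a<)) a<
    1+r≤ = count-bound (typ G x) G′ G b′ b c c<

    a≢c : a ≢ c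
    a≢c refl = ℕₚ.<-asym a< c<

    rearrange : ∀ k r → 2 * (k + (2 + r)) ≡ (2 + r) + ((1 + r) + (1 + 2 * k))
    rearrange = solve 2 (λ k r → con 2 :* (k :+ (con 2 :+ r)) :=
                                 (con 2 :+ r) :+ ((con 1 :+ r) :+ (con 1 :+ con 2 :* k))) refl
      where open +-*-Solver

  by-matching :
    (Σ[ π ∈ Permutation n n ] ∀ v → ℓ′ (π ⟨$⟩ʳ v) ≡ ℓ v) ⊎ ∃[ a ] count _≟ˡ_ ℓ′ a < count _≟ˡ_ ℓ a →
    (Σ[ π ∈ Permutation n n ] ∀ v → ℓ (π ⟨$⟩ʳ v) ≡ ℓ′ v) ⊎ ∃[ c ] count _≟ˡ_ ℓ c < count _≟ˡ_ ℓ′ c →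
    G ≅ G′
  by-matching (inj₁ (π , match)) _ = matching-≅ (typ G x) G G′ s s′ hom hom′ occurs occurs′ π match
  by-matching _ (inj₁ (π , match)) =
    ≅-sym {G = G′} {G} (matching-≅ (typ G x) G′ G s′ s hom′ hom occurs′ occurs π match)
  by-matching (inj₂ (_ , a<)) (inj₂ (_ , c<)) =
    contradiction (ℕₚ.≤-trans bound (excess a< c<)) (ℕₚ.<⇒≱ (ℕₚ.m<n+m (2 + n) (s≤s {n = 1} z≤n)))

-- Spoiler's strategy

lookup-ext : ∀ {A : Set} {k} {xs ys : Vec A k} → (∀ i → lookup xs i ≡ lookup ys i) → xs ≡ ys
lookup-ext {xs = xs} {ys} h =
  trans (sym (Vecₚ.tabulate∘lookup xs)) (trans (Vecₚ.tabulate-cong h) (Vecₚ.tabulate∘lookup ys))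

-- Replying in G′ and then in G again and again, Duplicator produces from x an
-- increasing chain for the preorder Below r, and by finiteness it has a cycle.

equivalent-positions : ∀ {n k r} (G G′ : Graph n) →
  Survives (k + r) G G′ [] [] → Survives (k + r) G′ G [] [] →
  ∀ (x : Vec (Fin n) k) →
  ∃[ y ] ∃[ y′ ] (Below r G G x y × Below r G G′ y y′ × Below r G′ G y′ y)
equivalent-positions {n} {k} {r} G G′ s s′ x =
  -- There are `n ^ k` tuples, so two of the first `1 + n ^ k` members of the orbit coincide.
  conclude (pigeonhole (ℕₚ.n<1+n (n ^ k)) (λ i → funToFin (lookup (orbit (toℕ i)))))
  where
  forth : ∀ y → ∃[ y′ ] Below r G G′ y y′
  forth y = play₀ G G′ y s

  back : ∀ y → ∃[ z ] Below r G′ G (proj₁ (forth y)) z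
  back y = play₀ G′ G (proj₁ (forth y)) s′

  orbit : ℕ → Vec (Fin n) k
  orbit = fold x (proj₁ ∘ back)

  ascend : ∀ i o → Below r G G (orbit i) (orbit (o + i))
  ascend i zero    = below-refl r G (orbit i)
  ascend i (suc o) = below-trans r (ascend i o)
    (below-trans r (proj₂ (forth (orbit (o + i)))) (proj₂ (back (orbit (o + i)))))

  ascend-≤ : ∀ {i j} → i ≤ j → Below r G G (orbit i) (orbit j)
  ascend-≤ {i} i≤j with ℕₚ.m≤n⇒∃[o]m+o≡n i≤j
  ... | o , refl = subst (λ j → Below r G G (orbit i) (orbit j)) (ℕₚ.+-comm o i) (ascend i o)

  conclude : (∃[ i ] ∃[ j ] (i Fin.< j ×
               funToFin (lookup (orbit (toℕ i))) ≡ funToFin (lookup (orbit (toℕ j))))) →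
             ∃[ y ] ∃[ y′ ] (Below r G G x y × Below r G G′ y y′ × Below r G′ G y′ y)
  conclude (i , j , i<j , e) =
    y , proj₁ (forth y) , ascend-≤ {0} {toℕ i} z≤n , proj₂ (forth y)
    -- From `y′` the chain continues to the successor of `y` in the orbit, then up to
    -- `orbit (toℕ j)`, which is `y` again.
    , below-trans r (proj₂ (back y)) (subst (Below r G G (proj₁ (back y))) (sym orbit-≡) (ascend-≤ i<j))
    where
    y = orbit (toℕ i)

    orbit-≡ : orbit (toℕ i) ≡ orbit (toℕ j)
    orbit-≡ = lookup-ext (λ l → trans (sym (finToFun-funToFin _ l))
                (trans (cong (λ m → finToFun m l) e) (finToFun-funToFin _ l)))

-- Rich G x (1 + 2 * k) forces k < n, so the extension of x must stop.

rich-≅ : ∀ fuel {n k R} (G G′ : Graph n) → 4 + n ≤ 2 * R → n ≤ k + fuel →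
         Survives R G G′ [] [] → Survives R G′ G [] [] → (x : Vec (Fin n) k) → Rich G x (1 + 2 * k) → G ≅ G′
rich-≅ zero {n} {k} G G′ _ n≤k _ _ x rich = contradiction
  (ℕₚ.≤-trans (rich-≤ G x rich) (subst (n ≤_) (ℕₚ.+-identityʳ k) n≤k)) (ℕₚ.<⇒≱ (s≤s (ℕₚ.m≤m+n k (k + 0))))
rich-≅ (suc fuel) {n} {k} {R} G G′ bound n≤ s s′ x rich
  with ℕₚ.m≤n⇒∃[o]m+o≡n (k+2≤ (rich-≤ G x rich))
  where
  k+2≤ : 1 + 2 * k ≤ n → k + 2 ≤ R
  k+2≤ h = ℕₚ.*-cancelˡ-≤ 2 (begin
    2 * (k + 2)    ≡⟨ ℕₚ.*-distribˡ-+ 2 k 2 ⟩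
    2 * k + 4      ≡⟨ ℕₚ.+-comm (2 * k) 4 ⟩
    4 + 2 * k      ≤⟨ ℕₚ.+-monoʳ-≤ 4 (ℕₚ.<⇒≤ h) ⟩
    4 + n          ≤⟨ bound ⟩
    2 * R          ∎)
    where open ℕₚ.≤-Reasoning
... | r , refl rewrite ℕₚ.+-assoc k 2 r with equivalent-positions G G′ s s′ x
...   | y , y′ , x≤y , y≤y′ , y′≤y =
  by-homogeneity (homogeneous-or-extend G y rich-y) (homogeneous-or-extend G′ y′ rich-y′)
  where
  rich-y : Rich G y (1 + 2 * k)
  rich-y = rich-below G G (proj₂ x≤y) rich

  rich-y′ : Rich G′ y′ (1 + 2 * k)
  rich-y′ = rich-below G G′ (proj₂ y≤y′) rich-y

  n≤′ : n ≤ suc k + fuel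
  n≤′ = subst (n ≤_) (ℕₚ.+-suc k fuel) n≤

  m≡ : 3 + 2 * k ≡ 1 + 2 * suc k
  m≡ = cong suc (sym (ℕₚ.*-suc 2 k))

  by-homogeneity : Homogeneous G y ⊎ ∃[ u ] Rich G (u ∷ y) (3 + 2 * k) →
                   Homogeneous G′ y′ ⊎ ∃[ u ] Rich G′ (u ∷ y′) (3 + 2 * k) → G ≅ G′
  by-homogeneity (inj₁ hom) (inj₁ hom′) = homogeneous-≅ G G′ bound rich-y y≤y′ y′≤y hom hom′
  -- The recursion restarts from the empty position, so `u ∷ y` needs no counterpart in `G′`. The
  -- two new types match the growth of `1 + 2 * k`.
  by-homogeneity (inj₂ (u , richer)) _  =
    rich-≅ fuel G G′ bound n≤′ s s′ (u ∷ y) (subst (Rich G (u ∷ y)) m≡ richer)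
  by-homogeneity _ (inj₂ (u , richer))  =
    ≅-sym {G = G′} {G} (rich-≅ fuel G′ G bound n≤′ s′ s (u ∷ y′) (subst (Rich G′ (u ∷ y′)) m≡ richer))

survives-≅ : ∀ {n R} (G G′ : Graph n) → 4 + n ≤ 2 * R →
             Survives R G G′ [] [] → Survives R G′ G [] [] → G ≅ G′
survives-≅ {zero}  G G′ _     _ _  = Perm.id , λ ()
survives-≅ {suc n} G G′ bound s s′ =
  -- Over the empty tuple any vertex realises the one type required, which is why order zero is
  -- treated apart.
  rich-≅ (suc n) G G′ bound ℕₚ.≤-refl s s′ [] (zero ∷ [] , [] ∷ [] , s≤s z≤n)

-- From the game to the minimum quantifier rank

uniform-alternationFree : ∀ {k q r} (Φ : Formula k) → Uniform q r Φ → AlternationFree r Φ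
uniform-alternationFree Φ = All.map (λ { {w} (u , l) → uniform-alternations w u , l })

alternationFree-¬ : ∀ {k r} (Φ : Formula k) → AlternationFree r Φ → AlternationFree r (¬′ Φ)
alternationFree-¬ {r = r} Φ h = Allₚ.map⁺ (All.map
  (λ { {w} (e , l) → trans (alternations-exchange w) e , subst (_≤ r) (sym (length-map exchange w)) l }) h)

alternationFree-intro : ∀ {k r} (Φ : Formula k) → alternationNumber Φ ≡ 0 → quantifierRank Φ ≤ r →
                        AlternationFree r Φ
alternationFree-intro Φ alt≡0 rank≤r = All.zip
  ( All.map (λ l → ℕₚ.n≤0⇒n≡0 (ℕₚ.≤-trans l (ℕₚ.≤-reflexive alt≡0)))
      (Allₚ.map⁻ (xs≤max 0 (List.map alternations (Nest Φ))))
  , All.map (λ l → ℕₚ.≤-trans l rank≤r) (Allₚ.map⁻ (xs≤max 0 (List.map length (Nest Φ)))))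

alternationFree-alternationNumber : ∀ {k r} (Φ : Formula k) → AlternationFree r Φ → alternationNumber Φ ≡ 0
alternationFree-alternationNumber Φ h =
  ℕₚ.n≤0⇒n≡0 (max≤v⁺ z≤n (Allₚ.map⁺ (All.map (ℕₚ.≤-reflexive ∘ proj₁) h)))

alternationFree-rank : ∀ {k r} (Φ : Formula k) → AlternationFree r Φ → quantifierRank Φ ≤ r
alternationFree-rank Φ h = max≤v⁺ z≤n (Allₚ.map⁺ (All.map proj₂ h))

-- If Spoiler wins only by staying in `G′`, the existential formula true on `G′` and false on `G` is
-- negated.
distinguish : ∀ {m n} r (G : Graph m) (G′ : Graph n) →
              ¬ (Survives r G G′ [] [] × Survives r G′ G [] []) →
              ∃[ Φ ] (AlternationFree r Φ × Distinguishes Φ G G′)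
distinguish r G G′ ¬both with survives? r G G′ [] []
... | no ¬s with separate r G G′ [] [] ¬s
...   | Φ , u , sat , ¬sat = Φ , uniform-alternationFree Φ u , sat , ¬sat
distinguish r G G′ ¬both | yes s with separate r G′ G [] [] (λ s′ → ¬both (s , s′))
...   | Φ , u , sat , ¬sat = ¬′ Φ , alternationFree-¬ Φ (uniform-alternationFree Φ u) , ¬sat , λ ¬sat′ → ¬sat′ sat

theorem5p1 : ∀ (n : ℕ) (G G′ : Graph n) → ¬ (G ≅ G′) →
    ∃[ d ] (IsD₀ G G′ d × 2 * d ≤ n + 5)
-- The minimum rank is the least number of rounds for which Duplicator loses one of the two games.
-- It is found by search up to `R`, as both games are decidable.
theorem5p1 n G G′ G≇G′ = conclude (¬∀⟶∃¬-smallest (suc R) (Both ∘ toℕ) (both? ∘ toℕ) ¬all)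
  where
  Both : ℕ → Set
  Both r = Survives r G G′ [] [] × Survives r G′ G [] []

  both? : ∀ r → Dec (Both r)
  both? r = survives? r G G′ [] [] ×-dec survives? r G′ G [] []

  R = ⌊ n + 5 /2⌋
  halves = ℕₚ.⌊n/2⌋+⌈n/2⌉≡n (n + 5)

  2R≤ : 2 * R ≤ n + 5
  2R≤ = begin
    R + (R + 0)          ≡⟨ cong (R +_) (ℕₚ.+-identityʳ R) ⟩
    R + R                ≤⟨ ℕₚ.+-monoʳ-≤ R (ℕₚ.⌊n/2⌋≤⌈n/2⌉ (n + 5)) ⟩
    R + ⌈ n + 5 /2⌉      ≡⟨ halves ⟩
    n + 5                ∎
    where open ℕₚ.≤-Reasoning

  -- Rounding down costs at most one, which is the difference between `n + 5` and `4 + n`.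
  ≤2R : 4 + n ≤ 2 * R
  ≤2R = ℕ.s≤s⁻¹ (begin
    5 + n                ≡⟨ ℕₚ.+-comm 5 n ⟩
    n + 5                ≡⟨ halves ⟨
    R + ⌈ n + 5 /2⌉      ≤⟨ ℕₚ.+-monoʳ-≤ R (ℕₚ.⌊n/2⌋-mono (ℕₚ.n≤1+n (suc (n + 5)))) ⟩
    R + suc R            ≡⟨ ℕₚ.+-suc R R ⟩
    suc (R + R)          ≡⟨ cong (λ m → suc (R + m)) (ℕₚ.+-identityʳ R) ⟨
    suc (2 * R)          ∎)
    where open ℕₚ.≤-Reasoning

  ¬all : ¬ (∀ (i : Fin (suc R)) → Both (toℕ i))
  ¬all h = G≇G′ (survives-≅ G G′ ≤2R (proj₁ both-R) (proj₂ both-R))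
    where both-R = subst Both (Finₚ.toℕ-fromℕ R) (h (Fin.fromℕ R))

  conclude : (∃[ i ] (¬ Both (toℕ {suc R} i) × ((j : Fin.Fin′ i) → Both (toℕ (Fin.inject j))))) →
             ∃[ d ] (IsD₀ G G′ d × 2 * d ≤ n + 5)
  conclude (i , ¬both , smaller) = toℕ i , record { attained = attained ; minimal = minimal }
                                 , ℕₚ.≤-trans (ℕₚ.*-monoʳ-≤ 2 (Finₚ.toℕ≤pred[n] i)) 2R≤
    where
    -- Duplicator survives both games for every smaller number of rounds, so no formula of smaller
    -- rank distinguishes the graphs.
    minimal : ∀ Φ → alternationNumber Φ ≡ 0 → Distinguishes Φ G G′ → toℕ i ≤ quantifierRank Φ
    minimal Φ alt≡0 (sat , ¬sat) = ℕₚ.≮⇒≥ λ rank<i →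
      let j    = fromℕ< rank<i
          both = subst Both (trans (Finₚ.toℕ-inject j) (Finₚ.toℕ-fromℕ< rank<i)) (smaller j)
      in ¬sat (agree (quantifierRank Φ) Φ (alternationFree-intro Φ alt≡0 ℕₚ.≤-refl)
                (tt , proj₁ both) (tt , proj₂ both) sat)

    attained : ∃[ Φ ] (alternationNumber Φ ≡ 0 × Distinguishes Φ G G′ × quantifierRank Φ ≡ toℕ i)
    attained with distinguish (toℕ i) G G′ ¬both
    ... | Φ , free , dist = Φ , alt≡0 , dist
                          -- The construction bounds the rank only from above; equality comes from
                          -- `minimal`.
                          , ℕₚ.≤-antisym (alternationFree-rank Φ free) (minimal Φ alt≡0 dist)
      where alt≡0 = alternationFree-alternationNumber Φ free
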